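{- Let $n\ge 1$ be an integer, let $q$ be a prime power, and let $M=(a_{i,j})\in \mathrm{U}(n,\mathbb{F}_q)$. Then $\mathrm{fr}(M)=1$ if and only if $M$ is diagonal and has exactly one nonzero diagonal entry. In particular, $s_q(n,1)=n(q-1)$.
   Context: $\mathbb{F}_q$ is the finite field with $q$ elements. $\mathrm{U}(n,\mathbb{F}_q)$ is the $\mathbb{F}_q$-vector space of $n\times n$ upper triangular matrices over $\mathbb{F}_q$ (entries $m_{i,j}=0$ whenever $i>j$). For $M\in \mathrm{U}(n,\mathbb{F}_q)$ and $1\le i\le n$, $M_{[i]}$ is the $i\times(n-i+1)$ submatrix of $M$ obtained by deleting the first $i-1$ columns and the last $n-i$ rows (i.e. rows $1,\dots,i$ and columns $i,\dots,n$). The flag-rank weight of $M$ is $\mathrm{fr}(M)=\sum_{i=1}^{n}\mathrm{rk}(M_{[i]})$. The number $s_q(n,t)$ is the size of the flag-rank sphere of radius $t$: $s_q(n,t)=|\{A\in \mathrm{U}(n,\mathbb{F}_q):\mathrm{fr}(A)=t\}|$. -}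

module Defs where

open import Level using (Level; _⊔_) renaming (suc to lsuc)
open import Algebra.Bundles using (CommutativeRing)
import Algebra.Properties.Monoid.Sum as Sum
open import Data.Fin.Base as Fin using (Fin; toℕ; inject≤; cast; _↑ʳ_; finToFun; funToFin)
import Data.Fin.Properties as Fin
open import Data.List.Base using (List; filter; upTo; allFin; length; lookup)
open import Data.List.Extrema.Nat using (max)
open import Data.List.Membership.Propositional using (_∈_)
open import Data.List.Membership.Propositional.Properties
  using (∈-filter⁺; ∈-filter⁻; ∈-allFin; ∈-lookup)
open import Data.List.Properties using (filter-≐)
open import Data.List.Relation.Unary.All as All using (All)
open import Data.List.Relation.Unary.AllPairs using (_∷_)
import Data.List.Relation.Unary.Any as Any
open import Data.List.Relation.Unary.Any.Properties using (lookup-index)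
open import Data.List.Relation.Unary.Unique.Propositional using (Unique)
import Data.List.Relation.Unary.Unique.Propositional.Properties as Unique
open import Data.Nat.Base using (ℕ; suc; _∸_; _^_; _≥_)
import Data.Nat.Properties as ℕ
open import Data.Nat.Primality using (Prime)
open import Data.Product.Base using (Σ; ∃; ∃₂; _×_; _,_; proj₁; proj₂)
open import Data.Vec.Functional using (Vector; transpose)
import Data.Vec.Functional.Relation.Binary.Equality.Setoid as VecEq
open import Function.Base using (_∘_)
open import Function.Bundles using (Inverse)
open import Relation.Binary.Bundles using (Setoid)
import Relation.Binary.Construct.On as On
open import Relation.Binary.Definitions using () renaming (Decidable to Decidable₂)
open import Relation.Binary.PropositionalEquality as ≡ using (_≡_; _≢_)
open import Relation.Nullary using (¬_; Dec; contradiction)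
open import Relation.Nullary.Decidable as Dec using (_×-dec_; _→-dec_)
open import Relation.Unary using (Pred; Decidable)

private
  variable
    a b p ℓ : Level

IsPrimePower : ℕ → Set
IsPrimePower q = ∃₂ λ p k → Prime p × k ≥ 1 × q ≡ p ^ k

record Field (c ℓ : Level) : Set (lsuc (c ⊔ ℓ)) where
  field
    commutativeRing : CommutativeRing c ℓ
  open CommutativeRing commutativeRing public
  field
    1≉0     : ¬ (1# ≈ 0#)
    inverse : ∀ x → ¬ (x ≈ 0#) → ∃ λ y → x * y ≈ 1#

------------------------------------------------------------------------
-- Finite setoids: Finite S carries a bijection between S and Fin (size), so a
-- size is by construction the cardinality up to the setoid equality

HasSize : Setoid a ℓ → ℕ → Set (a ⊔ ℓ)
HasSize S n = Inverse S (≡.setoid (Fin n))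

Finite : Setoid a ℓ → Set (a ⊔ ℓ)
Finite S = ∃ (HasSize S)

size : {S : Setoid a ℓ} → Finite S → ℕ
size = proj₁

Subset : (S : Setoid a ℓ) → Pred (Setoid.Carrier S) p → Setoid (a ⊔ p) ℓ
Subset S P = On.setoid {B = Σ (Setoid.Carrier S) P} S proj₁

private
  lookup-injective : {A : Set a} {xs : List A} → Unique xs →
                     ∀ i j → lookup xs i ≡ lookup xs j → i ≡ j
  lookup-injective (_ ∷ _) Fin.zero Fin.zero _ = ≡.refl
  lookup-injective (x∉ ∷ _) Fin.zero (Fin.suc j) eq =
    contradiction eq (All.lookup x∉ (∈-lookup j))
  lookup-injective (x∉ ∷ _) (Fin.suc i) Fin.zero eq =
    contradiction (≡.sym eq) (All.lookup x∉ (∈-lookup i))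
  lookup-injective (_ ∷ u) (Fin.suc i) (Fin.suc j) eq =
    ≡.cong Fin.suc (lookup-injective u i j eq)

module _ {S : Setoid a ℓ} {n : ℕ} (S-size : HasSize S n) where
  open Setoid S
  open Inverse S-size

  ≈-dec : Decidable₂ _≈_
  ≈-dec x y = Dec.map′
    (λ eq → trans (sym (strictlyInverseʳ x)) (trans (from-cong eq) (strictlyInverseʳ y)))
    to-cong
    (to x Fin.≟ to y)

  all-dec : {P : Pred Carrier p} → (∀ {x y} → x ≈ y → P x → P y) →
            Decidable P → Dec (∀ x → P x)
  all-dec resp P? = Dec.map′
    (λ h x → resp (strictlyInverseʳ x) (h (to x)))
    (λ h i → h (from i))
    (Fin.all? (P? ∘ from))

  any-dec : {P : Pred Carrier p} → (∀ {x y} → x ≈ y → P x → P y) →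
            Decidable P → Dec (∃ P)
  any-dec resp P? = Dec.map′
    (λ (i , pi) → from i , pi)
    (λ (x , px) → to x , resp (sym (strictlyInverseʳ x)) px)
    (Fin.any? (P? ∘ from))

  vector-size : ∀ k → HasSize (VecEq.≋-setoid S k) (n ^ k)
  vector-size k = record
    { to        = λ v → funToFin (to ∘ v)
    ; from      = λ i → from ∘ finToFun i
    ; to-cong   = λ eq → funToFin-cong (λ j → to-cong (eq j))
    ; from-cong = λ { ≡.refl _ → refl }
    ; inverse   =
        (λ {i} eq → ≡.trans
          (funToFin-cong (λ j → ≡.trans (to-cong (eq j)) (strictlyInverseˡ (finToFun i j))))
          (Fin.funToFin-finToFin {k} {n} i))
      , (λ { {v} ≡.refl j → trans
          (from-cong (Fin.finToFun-funToFin (to ∘ v) j)) (strictlyInverseʳ (v j)) })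
    }
    where
    funToFin-cong : ∀ {m k} {f g : Fin m → Fin k} → (∀ i → f i ≡ g i) → funToFin f ≡ funToFin g
    funToFin-cong {ℕ.zero}  eq = ≡.refl
    funToFin-cong {ℕ.suc m} eq = ≡.cong₂ Fin.combine (eq Fin.zero) (funToFin-cong (eq ∘ Fin.suc))

  subset-finite : {P : Pred Carrier p} → (∀ {x y} → x ≈ y → P x → P y) →
                  Decidable P → Finite (Subset S P)
  subset-finite {P = P} resp P? = length xs , record
    { to        = index
    ; from      = elem
    ; to-cong   = λ {x} {y} eq → xs-inj _ _
        (≡.trans (≡.sym (lookup-xs x)) (≡.trans (to-cong eq) (lookup-xs y)))
    ; from-cong = λ { ≡.refl → refl }
    ; inverse   =
        (λ {i} {x} eq → xs-inj _ _
          (≡.trans (≡.sym (lookup-xs x)) (≡.trans (to-cong eq) (strictlyInverseˡ (lookup xs i)))))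
      , (λ { {x} ≡.refl → trans (from-cong (≡.sym (lookup-xs x))) (strictlyInverseʳ (proj₁ x)) })
    }
    where
    xs : List (Fin n)
    xs = filter (P? ∘ from) (allFin n)

    xs-inj : ∀ i j → lookup xs i ≡ lookup xs j → i ≡ j
    xs-inj = lookup-injective (Unique.filter⁺ (P? ∘ from) (Unique.allFin⁺ n))

    to∈xs : (x : Σ Carrier P) → to (proj₁ x) ∈ xs
    to∈xs (x , px) =
      ∈-filter⁺ (P? ∘ from) (∈-allFin (to x)) (resp (sym (strictlyInverseʳ x)) px)

    index : Σ Carrier P → Fin (length xs)
    index x = Any.index (to∈xs x)

    lookup-xs : ∀ x → to (proj₁ x) ≡ lookup xs (index x)
    lookup-xs x = lookup-index (to∈xs x)

    elem : Fin (length xs) → Σ Carrier P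
    elem i = from (lookup xs i) ,
             proj₂ (∈-filter⁻ (P? ∘ from) {xs = allFin n} (∈-lookup i))

Fin-size : ∀ n → HasSize (≡.setoid (Fin n)) n
Fin-size n = record
  { to = λ i → i ; from = λ i → i
  ; to-cong = λ eq → eq ; from-cong = λ eq → eq
  ; inverse = (λ eq → eq) , (λ eq → eq)
  }

------------------------------------------------------------------------
-- Flag-rank over a field with q elements

module FlagRank {c ℓ : Level} (F : Field c ℓ) {q : ℕ}
                (F-size : HasSize (Field.setoid F) q) where

  open Field F
  open Sum +-monoid using (sum; sum-cong-≋)

  -- Entry (i , j), in row i and column j, is A i j; indices start at 0.
  Matrix : ℕ → ℕ → Set c
  Matrix m n = Vector (Vector Carrier n) m

  Matrix-setoid : ℕ → ℕ → Setoid c ℓ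
  Matrix-setoid m n = VecEq.≋-setoid (VecEq.≋-setoid setoid n) m

  _≈ᴹ_ : ∀ {m n} → Matrix m n → Matrix m n → Set ℓ
  _≈ᴹ_ {m} {n} = Setoid._≈_ (Matrix-setoid m n)

  Matrix-size : ∀ m n → HasSize (Matrix-setoid m n) ((q ^ n) ^ m)
  Matrix-size m n = vector-size (vector-size F-size n) m

  LinearlyIndependent : ∀ {m k} → Vector (Vector Carrier m) k → Set (c ⊔ ℓ)
  LinearlyIndependent {m} {k} v =
    ∀ (x : Vector Carrier k) →
    (∀ i → sum (λ j → x j * v j i) ≈ 0#) → ∀ j → x j ≈ 0#

  -- The selection f is automatically injective, as a family with a repeated
  -- member is dependent.
  HasIndependentColumns : ∀ {m n} → Matrix m n → ℕ → Set (c ⊔ ℓ)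
  HasIndependentColumns {n = n} A k =
    ∃ λ (f : Fin k → Fin n) → LinearlyIndependent (λ j → transpose A (f j))

  linearlyIndependent-resp : ∀ {m k} {v w : Vector (Vector Carrier m) k} →
    (∀ j i → v j i ≈ w j i) → LinearlyIndependent v → LinearlyIndependent w
  linearlyIndependent-resp v≈w ind x eq = ind x λ i →
    trans (sum-cong-≋ (λ j → *-congˡ (v≈w j i))) (eq i)

  linearlyIndependent? : ∀ {m k} (v : Vector (Vector Carrier m) k) →
                         Dec (LinearlyIndependent v)
  linearlyIndependent? {m} {k} v = all-dec (vector-size F-size k)
    (λ x≈y h eq j → trans (sym (x≈y j))
      (h (λ i → trans (sum-cong-≋ (λ l → *-congʳ (x≈y l))) (eq i)) j))
    (λ x → Fin.all? (λ i → ≈-dec F-size _ _) →-dec Fin.all? (λ j → ≈-dec F-size _ _))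

  hasIndependentColumns? : ∀ {m n} (A : Matrix m n) → Decidable (HasIndependentColumns A)
  hasIndependentColumns? {n = n} A k = any-dec (vector-size (Fin-size n) k)
    (λ f≗g → linearlyIndependent-resp
      (λ j i → reflexive (≡.cong (A i) (f≗g j))))
    (λ f → linearlyIndependent? _)

  -- The maximal number of linearly independent columns.
  rk : ∀ {m n} → Matrix m n → ℕ
  rk {n = n} A = max 0 (filter (hasIndependentColumns? A) (upTo (suc n)))

  rk-cong : ∀ {m n} {A B : Matrix m n} → A ≈ᴹ B → rk A ≡ rk B
  rk-cong {n = n} {A} {B} A≈B = ≡.cong (max 0)
    (filter-≐ (hasIndependentColumns? A) (hasIndependentColumns? B)
      ( (λ (f , ind) → f , linearlyIndependent-resp (λ j i → A≈B i (f j)) ind)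
      , (λ (f , ind) → f , linearlyIndependent-resp (λ j i → sym (A≈B i (f j))) ind))
      (upTo (suc n)))

  UpperTriangular : ∀ {n} → Matrix n n → Set ℓ
  UpperTriangular M = ∀ i j → i Fin.> j → M i j ≈ 0#

  Diagonal : ∀ {n} → Matrix n n → Set ℓ
  Diagonal M = ∀ i j → i ≢ j → M i j ≈ 0#

  -- M_[i]: with 0-based indices, rows 0 , … , i and columns i , … , n - 1.
  corner : ∀ {n} → Matrix n n → (i : Fin n) → Matrix (suc (toℕ i)) (n ∸ toℕ i)
  corner M i r c =
    M (inject≤ r (Fin.toℕ<n i)) (cast (ℕ.m+[n∸m]≡n (Fin.toℕ≤n i)) (toℕ i ↑ʳ c))

  open Sum ℕ.+-0-monoid using () renaming (sum to sumℕ; sum-cong-≗ to sumℕ-cong)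

  fr : ∀ {n} → Matrix n n → ℕ
  fr M = sumℕ (λ i → rk (corner M i))

  fr-cong : ∀ {n} {A B : Matrix n n} → A ≈ᴹ B → fr A ≡ fr B
  fr-cong {n} {A} {B} A≈B = sumℕ-cong {n} λ i →
    rk-cong {A = corner A i} {B = corner B i} (λ r c → A≈B _ _)

  Sphere : ℕ → ℕ → Setoid (c ⊔ ℓ) ℓ
  Sphere n t = Subset (Matrix-setoid n n) (λ A → UpperTriangular A × fr A ≡ t)

  Sphere-finite : ∀ n t → Finite (Sphere n t)
  Sphere-finite n t = subset-finite (Matrix-size n n)
    (λ A≈B (up , eq) →
        (λ i j i>j → trans (sym (A≈B i j)) (up i j i>j))
      , ≡.trans (≡.sym (fr-cong A≈B)) eq)
    (λ A → Fin.all? (λ i → Fin.all? (λ j → (j Fin.<? i) →-dec ≈-dec F-size _ _))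
           ×-dec (fr A ℕ.≟ t))

  s : ℕ → ℕ → ℕ
  s n t = size (Sphere-finite n t)

{-# OPTIONS --safe #-}

-- A nonzero entry (r , c) with r ≤ c lies in every corner M_[i] with r ≤ i ≤ c,
-- so an off-diagonal one, or two different diagonal ones, force two of the
-- ranks to be positive.  Conversely, if M is diagonal then M_[i] has no nonzero
-- entry except possibly M i i, so its rank is 1 or 0 according to whether
-- M i i is nonzero.  A matrix of flag-rank 1 is thus determined by a position i
-- and a nonzero element of the field.

module Submission where

open import Defs
import Algebra.Properties.CommutativeMonoid.Sum as CommutativeMonoidSum
import Algebra.Properties.Monoid.Sum as MonoidSum
import Algebra.Properties.Ring as RingProperties
import Data.Fin.Base as Fin
open import Data.Fin.Base
  using (Fin; toℕ; fromℕ<; punchIn; punchOut; combine; remQuot; inject≤; cast; _↑ʳ_)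
import Data.Fin.Permutation as Permutation
import Data.Fin.Properties as Fin
open import Data.List.Base using (filter; upTo)
open import Data.List.Extrema.Nat using (max≤v⁺; v≤max⁺)
open import Data.List.Membership.Propositional using (lose)
open import Data.List.Membership.Propositional.Properties using (∈-filter⁺; ∈-upTo⁺)
import Data.List.Relation.Unary.All as All
import Data.List.Relation.Unary.All.Properties as All
open import Data.Nat.Base using (ℕ; zero; suc; _+_; _≥_; _*_; _∸_; _≤_; z≤n; s≤s)
import Data.Nat.Properties as ℕ
open import Data.Product using (∃; ∃!; _×_; _,_; proj₁; proj₂)
open import Data.Sum.Base using (inj₂)
open import Data.Vec.Functional using (Vector; _∷_; replicate; removeAt)
open import Function.Bundles using (_⇔_; mk⇔; module Inverse)
import Function.Construct.Composition as Composition
import Function.Construct.Symmetry as Symmetry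
open import Level using (Level)
open import Relation.Binary.Bundles using (Setoid)
open import Relation.Binary.PropositionalEquality as ≡ using (_≡_; _≢_; cong)
import Relation.Binary.Reasoning.Setoid as SetoidReasoning
open import Relation.Nullary using (¬_; yes; no; contradiction)
open import Relation.Nullary.Decidable using (_×-dec_; ¬?; decidable-stable)

open CommutativeMonoidSum ℕ.+-0-commutativeMonoid using ()
  renaming (sum to sumℕ; sum-remove to sumℕ-remove;
            sum-cong-≗ to sumℕ-cong; sum-replicate-zero to sumℕ-zero)

-- Sums of natural numbers.

≤-sumℕ : ∀ {n} (f : Vector ℕ n) i → f i ≤ sumℕ f
≤-sumℕ {suc _} f i = ≡.subst (f i ≤_) (≡.sym (sumℕ-remove f)) (ℕ.m≤m+n _ _)

+-≤-sumℕ : ∀ {n} (f : Vector ℕ n) {i j} → i ≢ j → f i + f j ≤ sumℕ f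
+-≤-sumℕ {suc _} f {i} {j} i≢j = begin
  f i + f j                           ≡⟨ cong (λ k → f i + f k) (Fin.punchIn-punchOut i≢j) ⟨
  f i + removeAt f i (punchOut i≢j)   ≤⟨ ℕ.+-monoʳ-≤ (f i) (≤-sumℕ (removeAt f i) _) ⟩
  f i + sumℕ (removeAt f i)           ≡⟨ sumℕ-remove f ⟨
  sumℕ f                              ∎
  where open ℕ.≤-Reasoning

sumℕ-all-zero : ∀ {n} (f : Vector ℕ n) → (∀ i → f i ≡ 0) → sumℕ f ≡ 0
sumℕ-all-zero {n} f f≡0 = ≡.trans (sumℕ-cong f≡0) (sumℕ-zero n)

sumℕ-single : ∀ {n} (f : Vector ℕ n) i → (∀ j → j ≢ i → f j ≡ 0) → sumℕ f ≡ f i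
sumℕ-single {suc _} f i f≡0 = begin
  sumℕ f                      ≡⟨ sumℕ-remove f ⟩
  f i + sumℕ (removeAt f i)   ≡⟨ cong (f i +_) (sumℕ-all-zero (removeAt f i)
                                   (λ j → f≡0 _ (Fin.punchInᵢ≢i i j))) ⟩
  f i + 0                     ≡⟨ ℕ.+-identityʳ (f i) ⟩
  f i                         ∎
  where open ≡.≡-Reasoning

-- Cardinalities of setoids.

-- `s` is the length of one particular filtered list; this lets it be computed from any other
-- bijection.
HasSize-unique : ∀ {a ℓ} {S : Setoid a ℓ} {m n} → HasSize S m → HasSize S n → m ≡ n
HasSize-unique S-m S-n =
  Permutation.↔⇒≡ (Composition.inverse (Symmetry.inverse S-m) S-n)

-- `punchOut` and `punchIn` close and reopen the gap left at the index of `z`. With `z` taken to be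
-- `0#` it counts the nonzero field elements.
removePoint-size : ∀ {a ℓ} {S : Setoid a ℓ} {n} → HasSize S n → (z : Setoid.Carrier S) →
                   HasSize (Subset S (λ x → ¬ Setoid._≈_ S x z)) (n ∸ 1)
removePoint-size {n = zero} S-size z with () ← Inverse.to S-size z
removePoint-size {S = S} {suc n} S-size z = record
  { to        = λ (x , x≉z) → punchOut (to≢ x≉z)
  ; from      = λ k → from (punchIn (to z) k) , from≉ k
  ; to-cong   = λ eq → Fin.punchOut-cong (to z) (to-cong eq)
  ; from-cong = λ { ≡.refl → refl }
  ; inverse   =
      (λ {k} {x} eq → ≡.trans
        (Fin.punchOut-cong (to z) (≡.trans (to-cong eq) (strictlyInverseˡ _)))
        (Fin.punchOut-punchIn (to z)))
    , λ { {x , x≉z} ≡.refl → trans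
        (from-cong (Fin.punchIn-punchOut (to≢ x≉z))) (strictlyInverseʳ x) }
  }
  where
  open Setoid S
  open Inverse S-size

  to≢ : ∀ {x} → ¬ (x ≈ z) → to z ≢ to x
  to≢ {x} x≉z eq =
    x≉z (trans (sym (strictlyInverseʳ x)) (trans (from-cong (≡.sym eq)) (strictlyInverseʳ z)))

  from≉ : ∀ k → ¬ (from (punchIn (to z) k) ≈ z)
  from≉ k eq =
    Fin.punchInᵢ≢i (to z) k (≡.trans (≡.sym (strictlyInverseˡ _)) (to-cong eq))

module _ {c ℓ : Level} (F : Field c ℓ) {q : ℕ} (F-size : HasSize (Field.setoid F) q) where

  open Field F hiding (_+_; _*_)
  private module F = Field F
  open FlagRank F F-size
  open MonoidSum +-monoid using (sum; sum-cong-≋; sum-replicate-zero)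
  open RingProperties ring using (-‿distribˡ-*; -0#≈0#; -‿involutive)

  -- Linear dependence over the field.

  sum-all-zero : ∀ {k} (v : Vector Carrier k) → (∀ j → v j ≈ 0#) → sum v ≈ 0#
  sum-all-zero {k} v v≈0 = trans (sum-cong-≋ v≈0) (sum-replicate-zero k)

  x*y≈0⇒x≈0 : ∀ {x y} → ¬ (y ≈ 0#) → x F.* y ≈ 0# → x ≈ 0#
  x*y≈0⇒x≈0 {x} {y} y≉0 xy≈0 with y⁻¹ , yy⁻¹≈1 ← inverse y y≉0 = begin
    x                    ≈⟨ *-identityʳ x ⟨
    x F.* 1#             ≈⟨ *-congˡ yy⁻¹≈1 ⟨
    x F.* (y F.* y⁻¹)    ≈⟨ *-assoc x y y⁻¹ ⟨
    (x F.* y) F.* y⁻¹    ≈⟨ *-congʳ xy≈0 ⟩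
    0# F.* y⁻¹           ≈⟨ zeroˡ y⁻¹ ⟩
    0#                   ∎
    where open SetoidReasoning setoid

  -- If the head vanished, the coefficients `1, 0, …, 0` would give a nontrivial relation.
  linearlyIndependent⇒head≉0 : ∀ {m k} (v : Vector (Vector Carrier m) (suc k)) →
    LinearlyIndependent v → ¬ (∀ i → v Fin.zero i ≈ 0#)
  linearlyIndependent⇒head≉0 {k = k} v ind v₀≈0 = 1≉0 (ind x combination Fin.zero)
    where
    x : Vector Carrier (suc k)
    x = 1# ∷ replicate k 0#

    combination : ∀ i → sum (λ j → x j F.* v j i) ≈ 0#
    combination i = sum-all-zero (λ j → x j F.* v j i) λ
      { Fin.zero    → trans (*-identityˡ _) (v₀≈0 i)
      ; (Fin.suc j) → zeroˡ _ }

  -- The first two vectors v and w satisfy w r * v - v r * w = 0, so v r = 0.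
  supportedAt⇒dependent : ∀ {m k} (v : Vector (Vector Carrier m) (suc (suc k))) (r : Fin m) →
    (∀ j i → i ≢ r → v j i ≈ 0#) → ¬ LinearlyIndependent v
  -- Once its entry at `r` is zero as well, the first vector is zero, which independence forbids.
  supportedAt⇒dependent {m} {k} v r v≈0 ind = linearlyIndependent⇒head≉0 v ind v₀≈0
    where
    v₀ v₁ : Vector Carrier m
    v₀ = v Fin.zero
    v₁ = v (Fin.suc Fin.zero)

    x : Vector Carrier (suc (suc k))
    x = v₁ r ∷ (- v₀ r) ∷ replicate k 0#

    combination : ∀ i → sum (λ j → x j F.* v j i) ≈ 0#
    combination i with i Fin.≟ r
    ... | no i≢r = sum-all-zero (λ j → x j F.* v j i) λ j → trans (*-congˡ (v≈0 j i i≢r)) (zeroʳ (x j))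
    ... | yes ≡.refl = begin
      v₁ r F.* v₀ r F.+ (- v₀ r F.* v₁ r F.+ sum tail)
        ≈⟨ +-congˡ (+-cong (sym (-‿distribˡ-* _ _)) (sum-all-zero tail (λ j → zeroˡ _))) ⟩
      v₁ r F.* v₀ r F.+ (- (v₀ r F.* v₁ r) F.+ 0#)
        ≈⟨ +-cong (*-comm _ _) (+-identityʳ _) ⟩
      v₀ r F.* v₁ r F.+ - (v₀ r F.* v₁ r)
        ≈⟨ -‿inverseʳ _ ⟩
      0# ∎
      where
      open SetoidReasoning setoid

      tail : Vector Carrier k
      tail j = 0# F.* v (Fin.suc (Fin.suc j)) r

    v₀≈0 : ∀ i → v₀ i ≈ 0#
    v₀≈0 i with i Fin.≟ r
    ... | no i≢r = v≈0 Fin.zero i i≢r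
    ... | yes ≡.refl = trans (sym (-‿involutive _))
      (trans (-‿cong (ind x combination (Fin.suc Fin.zero))) -0#≈0#)

  -- Bounds on the rank.

  rk-≤ : ∀ {m n b} (A : Matrix m n) → (∀ k → HasIndependentColumns A k → k ≤ b) → rk A ≤ b
  -- The `z≤n` is for the default value `0` of `max`; the rest concerns the list members, all of
  -- which pass the filter.
  rk-≤ {n = n} A bound = max≤v⁺ {xs = filter (hasIndependentColumns? A) (upTo (suc n))} z≤n
    (All.map (bound _) (All.all-filter (hasIndependentColumns? A) (upTo (suc n))))

  -- `rk` searches only the sizes `0, …, n`, so `k ≤ n` places `k` in the searched list.
  ≤-rk : ∀ {m n k} (A : Matrix m n) → k ≤ n → HasIndependentColumns A k → k ≤ rk A
  ≤-rk A k≤n ind = v≤max⁺ 0 _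
    (inj₂ (lose (∈-filter⁺ (hasIndependentColumns? A) (∈-upTo⁺ (s≤s k≤n)) ind) ℕ.≤-refl))

  rk-zero : ∀ {m n} (A : Matrix m n) → (∀ r c → A r c ≈ 0#) → rk A ≡ 0
  rk-zero A A≈0 = ℕ.n≤0⇒n≡0 (rk-≤ A λ
    { zero    _         → z≤n
    ; (suc k) (f , ind) →
        contradiction (λ i → A≈0 i (f Fin.zero))
          (linearlyIndependent⇒head≉0 (λ j i → A i (f j)) ind) })

  -- All columns are multiples of one coordinate vector, so any two of them are dependent.
  rk-singleRow : ∀ {m n} (A : Matrix m n) r → (∀ i c → i ≢ r → A i c ≈ 0#) → rk A ≤ 1
  rk-singleRow A r A≈0 = rk-≤ A λ
    { zero          _         → z≤n
    ; (suc zero)    _         → ℕ.≤-refl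
    ; (suc (suc k)) (f , ind) →
        contradiction ind
          (supportedAt⇒dependent (λ j i → A i (f j)) r (λ j i → A≈0 i (f j))) }

  rk-nonzero : ∀ {m n} (A : Matrix m n) r c → ¬ (A r c ≈ 0#) → 1 ≤ rk A
  -- The index `c` itself shows that there is at least one column. Row `r` of a relation on column
  -- `c` alone reads `x * A r c + 0 = 0`.
  rk-nonzero A r c Arc≉0 = ≤-rk A (ℕ.≤-trans (s≤s z≤n) (Fin.toℕ<n c))
    ((λ _ → c) , λ { x eq Fin.zero → x*y≈0⇒x≈0 Arc≉0 (trans (sym (+-identityʳ _)) (eq r)) })

  -- Positions inside the corners.

  module _ {n : ℕ} (i : Fin n) where

    -- `cornerRow` and `cornerColumn` are the index maps inlined in `corner`, so `corner M i r c` is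
    -- by definition `M (cornerRow i r) (cornerColumn i c)`.
    cornerRow : Fin (suc (toℕ i)) → Fin n
    cornerRow r = inject≤ r (Fin.toℕ<n i)

    cornerColumn : Fin (n ∸ toℕ i) → Fin n
    cornerColumn c = cast (ℕ.m+[n∸m]≡n (Fin.toℕ≤n i)) (toℕ i ↑ʳ c)

    cornerRow≤ : ∀ r → cornerRow r Fin.≤ i
    cornerRow≤ r = ≡.subst (_≤ toℕ i) (≡.sym (Fin.toℕ-inject≤ r _)) (Fin.toℕ≤pred[n] r)

    toℕ-cornerColumn : ∀ c → toℕ (cornerColumn c) ≡ toℕ i + toℕ c
    toℕ-cornerColumn c = ≡.trans (Fin.toℕ-cast _ _) (Fin.toℕ-↑ʳ (toℕ i) c)

    ≤cornerColumn : ∀ c → i Fin.≤ cornerColumn c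
    ≤cornerColumn c = ≡.subst (toℕ i ≤_) (≡.sym (toℕ-cornerColumn c)) (ℕ.m≤m+n _ _)

    cornerRow-surjective : ∀ {r} → r Fin.≤ i → ∃ λ r′ → cornerRow r′ ≡ r
    cornerRow-surjective r≤i = fromℕ< (s≤s r≤i) ,
      Fin.toℕ-injective (≡.trans (Fin.toℕ-inject≤ _ _) (Fin.toℕ-fromℕ< _))

    cornerColumn-surjective : ∀ {c} → i Fin.≤ c → ∃ λ c′ → cornerColumn c′ ≡ c
    cornerColumn-surjective {c} i≤c = fromℕ< (ℕ.∸-monoˡ-< (Fin.toℕ<n c) i≤c) ,
      Fin.toℕ-injective (≡.trans (toℕ-cornerColumn _)
        (≡.trans (cong (toℕ i +_) (Fin.toℕ-fromℕ< _)) (ℕ.m+[n∸m]≡n i≤c)))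

  rk-corner-positive : ∀ {n} (M : Matrix n n) {i r c} → r Fin.≤ i → i Fin.≤ c →
                       ¬ (M r c ≈ 0#) → 1 ≤ rk (corner M i)
  rk-corner-positive M {i} r≤i i≤c Mrc≉0
    with r′ , ≡.refl ← cornerRow-surjective i r≤i
       | c′ , ≡.refl ← cornerColumn-surjective i i≤c
    = rk-nonzero (corner M i) r′ c′ Mrc≉0

  -- Corners of a diagonal matrix.

  module _ {n : ℕ} {M : Matrix n n} (M-diagonal : Diagonal M) where

    -- Rows of the corner are at most `i` and columns at least `i`, so they can agree only at `i`.
    -- The premise is conditional to serve two cases: all of the corner when `M i i` is zero, and
    -- its rows other than that of `i` when it is not.
    corner-zero : ∀ i r c → (cornerRow i r ≡ i → M i i ≈ 0#) → corner M i r c ≈ 0#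
    corner-zero i r c Mii≈0 with cornerRow i r Fin.≟ cornerColumn i c
    ... | no  r≢c = M-diagonal _ _ r≢c
    ... | yes r≡c = ≡.subst₂ (λ x y → M x y ≈ 0#) (≡.sym r≡i) (≡.trans (≡.sym r≡i) r≡c) (Mii≈0 r≡i)
      where
      r≡i : cornerRow i r ≡ i
      r≡i = Fin.≤-antisym (cornerRow≤ i r)
        (≡.subst (i Fin.≤_) (≡.sym r≡c) (≤cornerColumn i c))

    rk-corner-zero : ∀ i → M i i ≈ 0# → rk (corner M i) ≡ 0
    rk-corner-zero i Mii≈0 = rk-zero (corner M i) λ r c → corner-zero i r c (λ _ → Mii≈0)

    rk-corner-one : ∀ i → ¬ (M i i ≈ 0#) → rk (corner M i) ≡ 1
    rk-corner-one i Mii≉0 with r , r≡i ← cornerRow-surjective i (ℕ.≤-refl {toℕ i}) =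
      ℕ.≤-antisym
        (rk-singleRow (corner M i) r λ r′ c r′≢r → corner-zero i r′ c λ r′≡i →
          contradiction (Fin.inject≤-injective _ _ r′ r (≡.trans r′≡i (≡.sym r≡i))) r′≢r)
        (rk-corner-positive M ℕ.≤-refl ℕ.≤-refl Mii≉0)

  -- Characterisation of flag-rank one.

  HasUniquePivot : ∀ {n} → Matrix n n → Set ℓ
  HasUniquePivot {n} M = ∃! _≡_ (λ (i : Fin n) → ¬ (M i i ≈ 0#))

  module _ {n : ℕ} {M : Matrix n n} where

    -- Two distinct positive corners would already contribute 2 to the sum.
    positiveCorners-unique : fr M ≡ 1 → ∀ {i j} →
                             1 ≤ rk (corner M i) → 1 ≤ rk (corner M j) → i ≡ j
    positiveCorners-unique fr≡1 {i} {j} 1≤i 1≤j = decidable-stable (i Fin.≟ j) λ i≢j →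
      ℕ.1+n≰n (≡.subst (2 ≤_) fr≡1
        (ℕ.≤-trans (ℕ.+-mono-≤ 1≤i 1≤j) (+-≤-sumℕ (λ k → rk (corner M k)) i≢j)))

    fr≡1⇒diagonal : UpperTriangular M → fr M ≡ 1 → Diagonal M
    -- Equality in a finite field is decidable, so contradiction is available: a nonzero entry makes
    -- the corners at `r` and at `c` both positive.
    fr≡1⇒diagonal upper fr≡1 r c r≢c = decidable-stable (≈-dec F-size _ _) λ Mrc≉0 →
      let r≤c = ℕ.≮⇒≥ λ r>c → Mrc≉0 (upper r c r>c) in
      r≢c (positiveCorners-unique fr≡1
        (rk-corner-positive M ℕ.≤-refl r≤c Mrc≉0)
        (rk-corner-positive M r≤c ℕ.≤-refl Mrc≉0))

    abstract
      -- Without a nonzero diagonal entry the matrix, being diagonal, has only zero corners and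
      -- flag-rank 0. The result is abstract: later the pivot is identified by its uniqueness, never
      -- by unfolding the search.
      fr≡1⇒uniquePivot : UpperTriangular M → fr M ≡ 1 → HasUniquePivot M
      fr≡1⇒uniquePivot upper fr≡1 with Fin.any? (λ i → ¬? (≈-dec F-size (M i i) 0#))
      ... | yes (i , Mii≉0) = i , Mii≉0 , λ Mjj≉0 → positiveCorners-unique fr≡1
              (rk-corner-positive M ℕ.≤-refl ℕ.≤-refl Mii≉0)
              (rk-corner-positive M ℕ.≤-refl ℕ.≤-refl Mjj≉0)
      ... | no none = contradiction (≡.trans (≡.sym fr≡1) fr≡0) λ ()
        where
        fr≡0 : fr M ≡ 0
        fr≡0 = sumℕ-all-zero (λ i → rk (corner M i)) λ i →
          rk-corner-zero {M = M} (fr≡1⇒diagonal upper fr≡1) i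
            (decidable-stable (≈-dec F-size _ _) λ Mii≉0 → none (i , Mii≉0))

      diagonal∧uniquePivot⇒fr≡1 : Diagonal M → HasUniquePivot M → fr M ≡ 1
      diagonal∧uniquePivot⇒fr≡1 diagonal (i , Mii≉0 , unique) = ≡.trans
        (sumℕ-single (λ j → rk (corner M j)) i λ j j≢i →
          rk-corner-zero {M = M} diagonal j
            (decidable-stable (≈-dec F-size _ _) λ Mjj≉0 → j≢i (≡.sym (unique Mjj≉0))))
        (rk-corner-one {M = M} diagonal i Mii≉0)

  -- Counting the sphere of radius one.

  Nonzero : Setoid _ _
  Nonzero = Subset setoid (λ x → ¬ (x ≈ 0#))

  -- The scalar multiple `x E_ii` of a diagonal matrix unit.
  matrixUnit : ∀ {n} → Fin n → Carrier → Matrix n n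
  matrixUnit i x r c with r Fin.≟ i ×-dec c Fin.≟ i
  ... | yes _ = x
  ... | no  _ = 0#

  matrixUnit-pivot : ∀ {n} (i : Fin n) x → matrixUnit i x i i ≈ x
  matrixUnit-pivot i x with i Fin.≟ i ×-dec i Fin.≟ i
  ... | yes _  = refl
  ... | no  ¬p = contradiction (≡.refl , ≡.refl) ¬p

  matrixUnit-zero : ∀ {n} (i : Fin n) x {r c} → ¬ (r ≡ i × c ≡ i) → matrixUnit i x r c ≈ 0#
  matrixUnit-zero i x {r} {c} ¬p with r Fin.≟ i ×-dec c Fin.≟ i
  ... | yes p = contradiction p ¬p
  ... | no  _ = refl

  matrixUnit-cong : ∀ {n} (i : Fin n) {x y} → x ≈ y → matrixUnit i x ≈ᴹ matrixUnit i y
  matrixUnit-cong i x≈y r c with r Fin.≟ i ×-dec c Fin.≟ i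
  ... | yes _ = x≈y
  ... | no  _ = refl

  -- Recovers a sphere member from its pivot and the entry there, for the bijection that follows.
  diagonal⇒≈matrixUnit : ∀ {n} {M : Matrix n n} → Diagonal M →
    ((i , _) : HasUniquePivot M) → matrixUnit i (M i i) ≈ᴹ M
  diagonal⇒≈matrixUnit {M = M} diagonal (i , _ , unique) r c
    with r Fin.≟ i ×-dec c Fin.≟ i
  ... | yes (≡.refl , ≡.refl) = refl
  ... | no ¬p with r Fin.≟ c
  ...   | no r≢c = sym (diagonal r c r≢c)
  ...   | yes ≡.refl = sym (decidable-stable (≈-dec F-size _ _) λ Mrr≉0 →
            let r≡i = ≡.sym (unique Mrr≉0) in ¬p (r≡i , r≡i))

  module _ {n : ℕ} (i : Fin n) {x : Carrier} (x≉0 : ¬ (x ≈ 0#)) where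

    matrixUnit-diagonal : Diagonal (matrixUnit i x)
    matrixUnit-diagonal r c r≢c =
      matrixUnit-zero i x λ (r≡i , c≡i) → r≢c (≡.trans r≡i (≡.sym c≡i))

    matrixUnit-uniquePivot : HasUniquePivot (matrixUnit i x)
    matrixUnit-uniquePivot = i
      , (λ eq → x≉0 (trans (sym (matrixUnit-pivot i x)) eq))
      , λ {j} Ejj≉0 → decidable-stable (i Fin.≟ j) λ i≢j →
          Ejj≉0 (matrixUnit-zero i x λ (j≡i , _) → i≢j (≡.sym j≡i))

    matrixUnit∈Sphere : Setoid.Carrier (Sphere n 1)
    matrixUnit∈Sphere = matrixUnit i x
      , (λ r c r>c → matrixUnit-diagonal r c (λ r≡c → Fin.<⇒≢ r>c (≡.sym r≡c)))
      , diagonal∧uniquePivot⇒fr≡1 {M = matrixUnit i x} matrixUnit-diagonal matrixUnit-uniquePivot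

  -- A matrix corresponds to its pivot together with the index of the pivot entry among the nonzero
  -- elements; `combine` and `remQuot` encode such pairs in `Fin (n * (q ∸ 1))`.
  Sphere-size : ∀ n → HasSize (Sphere n 1) (n * (q ∸ 1))
  Sphere-size n = record
    { to        = λ A → combine (pivot A) (N.to (entry A))
    ; from      = λ k → from (remQuot (q ∸ 1) k)
    ; to-cong   = λ {A} {B} → to-cong {A} {B}
    ; from-cong = λ { ≡.refl _ _ → refl }
    ; inverse   = (λ {k} {A} → inverseˡ {k} {A})
                , λ { {A} ≡.refl → inverseʳ A }
    }
    where
    module N = Inverse (removePoint-size F-size 0#)
    module Sph = Setoid (Sphere n 1)

    hasUniquePivot : (A : Sph.Carrier) → HasUniquePivot (proj₁ A)
    hasUniquePivot (M , upper , fr≡1) = fr≡1⇒uniquePivot upper fr≡1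

    pivot : Sph.Carrier → Fin n
    pivot A = proj₁ (hasUniquePivot A)

    entry : Sph.Carrier → Setoid.Carrier Nonzero
    entry A = proj₁ A (pivot A) (pivot A) , proj₁ (proj₂ (hasUniquePivot A))

    from : Fin n × Fin (q ∸ 1) → Sph.Carrier
    from (i , k) = matrixUnit∈Sphere i (proj₂ (N.from k))

    ≈⇒pivot≡ : ∀ {A B} → A Sph.≈ B → pivot A ≡ pivot B
    -- The pivots come from separate searches, but `A` is also nonzero at the pivot of `B`, so
    -- uniqueness for `A` applies.
    ≈⇒pivot≡ {A} {B} A≈B = proj₂ (proj₂ (hasUniquePivot A)) λ eq →
      proj₂ (entry B) (trans (sym (A≈B _ _)) eq)

    to-cong : ∀ {A B} → A Sph.≈ B →
              combine (pivot A) (N.to (entry A)) ≡ combine (pivot B) (N.to (entry B))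
    to-cong {A} {B} A≈B = ≡.cong₂ combine A≡B (N.to-cong
      (trans (reflexive (cong (λ i → proj₁ A i i) A≡B)) (A≈B _ _)))
      where A≡B = ≈⇒pivot≡ {A} {B} A≈B

    to∘from : ∀ i k → combine (pivot (from (i , k))) (N.to (entry (from (i , k)))) ≡ combine i k
    to∘from i k = ≡.cong₂ combine pivot≡i (≡.trans
      (N.to-cong {y = N.from k} (trans
        (reflexive (cong (λ j → proj₁ (from (i , k)) j j) pivot≡i))
        (matrixUnit-pivot i (proj₁ (N.from k)))))
      (N.strictlyInverseˡ k))
      where
      pivot≡i : pivot (from (i , k)) ≡ i
      -- The uniqueness used is that of the explicit pivot `i` of the matrix unit, applied to the
      -- pivot found by the search.
      pivot≡i = ≡.sym (proj₂ (proj₂ (matrixUnit-uniquePivot i (proj₂ (N.from k))))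
        (proj₂ (entry (from (i , k)))))

    inverseˡ : ∀ {k A} → A Sph.≈ from (remQuot (q ∸ 1) k) →
               combine (pivot A) (N.to (entry A)) ≡ k
    inverseˡ {k} {A} A≈ = ≡.trans (to-cong {A} {from (remQuot (q ∸ 1) k)} A≈)
      (≡.trans (to∘from _ _) (Fin.combine-remQuot {n} (q ∸ 1) k))

    inverseʳ : ∀ A → from (remQuot (q ∸ 1) (combine (pivot A) (N.to (entry A)))) Sph.≈ A
    inverseʳ A@(M , upper , fr≡1) = ≡.subst (λ p → from p Sph.≈ A)
      (≡.sym (Fin.remQuot-combine {n} (pivot A) (N.to (entry A))))
      λ r c → trans
        -- Decoding returns the entry only up to `≈`, so it is first replaced by the actual entry of
        -- `M`.
        (matrixUnit-cong (pivot A) (N.strictlyInverseʳ (entry A)) r c)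
        (diagonal⇒≈matrixUnit {M = M} (fr≡1⇒diagonal upper fr≡1) (hasUniquePivot A) r c)

proposition3p1 : ∀ {c ℓ : Level} (n : ℕ) → n ≥ 1 → (q : ℕ) → IsPrimePower q →
    (F : Field c ℓ) (F-size : HasSize (Field.setoid F) q) →
    let open Field F using (_≈_)
        open Field F using (0#)
        open FlagRank F F-size
    in ((M : Matrix n n) → UpperTriangular M →
          (fr M ≡ 1) ⇔ (Diagonal M × ∃! _≡_ (λ (i : Fin n) → ¬ (M i i ≈ 0#))))
       × (s n 1 ≡ n * (q ∸ 1))
proposition3p1 n _ q _ F F-size =
    (λ M upper → mk⇔
      (λ fr≡1 → fr≡1⇒diagonal F F-size upper fr≡1 , fr≡1⇒uniquePivot F F-size upper fr≡1)
      (λ (diagonal , pivot) → diagonal∧uniquePivot⇒fr≡1 F F-size {M = M} diagonal pivot))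
  , HasSize-unique (proj₂ (FlagRank.Sphere-finite F F-size n 1)) (Sphere-size F F-size n)
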